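{- In the preemptive FIFO buffer management problem, let $B$ be a buffer state and $\sigma$ an input sequence. Let $\mathrm{OPT}_{\emptyset}(\sigma)$ and $\mathrm{OPT}_B(\sigma)$ denote the optimal schedules constructed strictly from packets arriving in the future input sequence $\sigma$, starting from buffer states $\emptyset$ and $B$, respectively (i.e. the packets of $\sigma$ transmitted by the optimal schedule on $\sigma$ started from $\emptyset$, respectively from $B$). Then $$v(\mathrm{OPT}_{\emptyset}(\sigma))\ \ge\ v(\mathrm{OPT}_B(\sigma)).$$
   Context: Preemptive FIFO buffer management. A buffer has fixed finite capacity. Time is discrete, $i\in\{1,\dots,T\}$. An input is $\sigma=(\sigma_1,\dots,\sigma_T)$, where $\sigma_i=(p_{i_1},\dots,p_{i_k})$, $k\in\mathbb{Z}_+$, is the sequence of packets arriving at step $i$; each packet $p$ has a nonnegative real value $v(p)$. Each step has two phases. Arrival phase: for each arriving packet in turn, the algorithm immediately accepts or drops it, and it may preempt (permanently discard) any packets in the buffer; an accepted packet is placed at the tail of the buffer, and the capacity may never be exceeded. Transmission phase: after all arrivals of the step, the packet at the head of the buffer (if any) is transmitted and its value is gained. A buffer state $B$ is a FIFO-ordered list of packets respecting the capacity. Starting from $B$ means that before step 1 the buffer contains $B$; its packets may be transmitted or preempted like any others. $\mathrm{OPT}(B,\sigma)$ is an offline optimal schedule (maximum total transmitted value, counting packets of both $B$ and $\sigma$) on $\sigma$ starting from $B$. $\mathrm{OPT}_B(\sigma)$ is the part of $\mathrm{OPT}(B,\sigma)$ consisting of transmitted packets that arrive in $\sigma$ (as opposed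 to those originally in $B$). The value $v(\cdot)$ of a schedule is the sum of the values of its packets. -}

module Defs where

open import Algebra.Bundles using (CommutativeMonoid)
open import Data.Integer.Base using (+_)
open import Data.List.Base using (List; []; _∷_; _∷ʳ_; _++_; foldr; length; map; mapMaybe)
open import Data.List.Relation.Binary.Sublist.Propositional using (_⊆_)
open import Data.Nat.Base as ℕ using (ℕ; suc)
open import Data.Nat.Coprimality using (1-coprimeTo)
import Data.Nat.Tactic.RingSolver as ℕ-Solver
open import Data.Rational.Base as ℚ using (ℚ; mkℚ; 0ℚ; ∣_∣)
import Data.Rational.Properties as ℚ
import Data.Rational.Unnormalised.Base as ℚᵘ
import Data.Rational.Unnormalised.Properties as ℚᵘ
open import Data.Sum using (_⊎_; inj₁; inj₂; [_,_]′; isInj₂)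
open import Data.Vec.Base using (Vec; []; _∷_)
open import Function.Base using (id)
open import Relation.Binary.PropositionalEquality

-- Real numbers, as regular Cauchy sequences of rationals (Bishop): seq n is
-- within 1/(n+1) of the real it represents.

1/1+_ : ℕ → ℚ
1/1+ n = mkℚ (+ 1) n (1-coprimeTo (suc n))

record ℝ : Set where
  constructor mkℝ
  field
    seq     : ℕ → ℚ
    regular : ∀ m n → ∣ seq m ℚ.- seq n ∣ ℚ.≤ 1/1+ m ℚ.+ 1/1+ n

open ℝ public

infix 4 _≤ℝ_ _≥ℝ_

-- Bishop's order. The slack 2/(n+1) absorbs the two approximation errors, so
-- this is the order of the limits and not a termwise comparison.
_≤ℝ_ : ℝ → ℝ → Set
x ≤ℝ y = ∀ n → seq x n ℚ.≤ seq y n ℚ.+ (1/1+ n ℚ.+ 1/1+ n)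

_≥ℝ_ : ℝ → ℝ → Set
x ≥ℝ y = y ≤ℝ x

0ℝ : ℝ
0ℝ = mkℝ (λ _ → 0ℚ) λ m n → ℚ.+-mono-≤ (ℚ.nonNegative⁻¹ (1/1+ m)) (ℚ.nonNegative⁻¹ (1/1+ n))

-- The index in a sum, satisfying 1/(double n + 1) = 1/(2(n+1)).
double : ℕ → ℕ
double n = n ℕ.+ suc n

-- These proofs are abstract since normalising them is prohibitively slow.
abstract

  1/1+double : ∀ n → 1/1+ double n ℚ.+ 1/1+ double n ≡ 1/1+ n
  1/1+double n = ℚ.toℚᵘ-injective
    (ℚᵘ.≃-trans (ℚ.toℚᵘ-homo-+ (1/1+ double n) (1/1+ double n))
                (ℚᵘ.*≡* (cong +_ (identity n))))
    where
    identity : ∀ n → (1 ℕ.* suc (n ℕ.+ suc n) ℕ.+ 1 ℕ.* suc (n ℕ.+ suc n)) ℕ.* suc n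
                     ≡ 1 ℕ.* (suc (n ℕ.+ suc n) ℕ.* suc (n ℕ.+ suc n))
    identity = ℕ-Solver.solve-∀

  +-regular : ∀ a b c d {e f g h} → ∣ a ℚ.- c ∣ ℚ.≤ e ℚ.+ f → ∣ b ℚ.- d ∣ ℚ.≤ e ℚ.+ f →
              e ℚ.+ e ≡ g → f ℚ.+ f ≡ h → ∣ (a ℚ.+ b) ℚ.- (c ℚ.+ d) ∣ ℚ.≤ g ℚ.+ h
  +-regular a b c d {e} {f} {g} {h} a-c b-d e+e f+f = begin
    ∣ (a ℚ.+ b) ℚ.- (c ℚ.+ d) ∣           ≡⟨ cong (λ z → ∣ (a ℚ.+ b) ℚ.+ z ∣) (ℚ.neg-distrib-+ c d) ⟩
    ∣ (a ℚ.+ b) ℚ.+ (ℚ.- c ℚ.+ ℚ.- d) ∣   ≡⟨ cong ∣_∣ (interchange a b (ℚ.- c) (ℚ.- d)) ⟩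
    ∣ (a ℚ.- c) ℚ.+ (b ℚ.- d) ∣           ≤⟨ ℚ.∣p+q∣≤∣p∣+∣q∣ (a ℚ.- c) (b ℚ.- d) ⟩
    ∣ a ℚ.- c ∣ ℚ.+ ∣ b ℚ.- d ∣           ≤⟨ ℚ.+-mono-≤ a-c b-d ⟩
    (e ℚ.+ f) ℚ.+ (e ℚ.+ f)               ≡⟨ interchange e f e f ⟩
    (e ℚ.+ e) ℚ.+ (f ℚ.+ f)               ≡⟨ cong₂ ℚ._+_ e+e f+f ⟩
    g ℚ.+ h                               ∎
    where
    open ℚ.≤-Reasoning
    open import Algebra.Properties.CommutativeSemigroup
      (CommutativeMonoid.commutativeSemigroup ℚ.+-0-commutativeMonoid) using (interchange)

infixl 6 _+ℝ_

_+ℝ_ : ℝ → ℝ → ℝ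
x +ℝ y = mkℝ (λ n → seq x (double n) ℚ.+ seq y (double n)) λ m n →
  +-regular (seq x (double m)) (seq y (double m)) (seq x (double n)) (seq y (double n))
    {1/1+ double m} {1/1+ double n} {1/1+ m} {1/1+ n}
    (regular x (double m) (double n)) (regular y (double m) (double n))
    (1/1+double m) (1/1+double n)

record Packet : Set where
  field
    value  : ℝ
    nonneg : 0ℝ ≤ℝ value

open Packet public

v : List Packet → ℝ
v = foldr (λ p s → value p +ℝ s) 0ℝ

Input : ℕ → Set
Input T = Vec (List Packet) T

record BufferState (capacity : ℕ) : Set where
  field
    packets : List Packet
    fits    : length packets ℕ.≤ capacity

open BufferState public

∅ : ∀ {capacity} → BufferState capacity
∅ = record { packets = [] ; fits = ℕ.z≤n }

-- A packet together with its provenance: inj₁ for the packets of the starting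
-- buffer, inj₂ for those arriving in the input.
Tagged : Set
Tagged = Packet ⊎ Packet

-- Buffer contents during a run; the head of the list is the head of the queue.
Contents : Set
Contents = List Tagged

-- One arrival. The contents Q′ ⊆ Q (a sublist, hence in the same FIFO order)
-- are what remains of Q after preemption.
data Arrival (capacity : ℕ) (Q : Contents) (p : Packet) : Contents → Set where
  drop   : ∀ {Q′} → Q′ ⊆ Q → Arrival capacity Q p Q′
  accept : ∀ {Q′} → Q′ ⊆ Q → length (Q′ ∷ʳ inj₂ p) ℕ.≤ capacity →
           Arrival capacity Q p (Q′ ∷ʳ inj₂ p)

data ArrivalPhase (capacity : ℕ) : Contents → List Packet → Contents → Set where
  []  : ∀ {Q} → ArrivalPhase capacity Q [] Q
  _∷_ : ∀ {Q Q′ Q″ p ps} → Arrival capacity Q p Q′ →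
        ArrivalPhase capacity Q′ ps Q″ → ArrivalPhase capacity Q (p ∷ ps) Q″

sent : Contents → List Tagged
sent []      = []
sent (p ∷ _) = p ∷ []

remaining : Contents → Contents
remaining []      = []
remaining (_ ∷ Q) = Q

data Run (capacity : ℕ) : ∀ {T} → Contents → Input T → Set where
  []  : ∀ {Q} → Run capacity Q []
  _∷_ : ∀ {T Q Q′ ps} {σ : Input T} → ArrivalPhase capacity Q ps Q′ →
        Run capacity (remaining Q′) σ → Run capacity Q (ps ∷ σ)

transmitted : ∀ {capacity T Q} {σ : Input T} → Run capacity Q σ → List Tagged
transmitted []                  = []
transmitted (_∷_ {Q′ = Q′} _ r) = sent Q′ ++ transmitted r

Schedule : ∀ {capacity T} → BufferState capacity → Input T → Set
Schedule {capacity} B σ = Run capacity (map inj₁ (packets B)) σ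

allPackets : ∀ {capacity T Q} {σ : Input T} → Run capacity Q σ → List Packet
allPackets r = map [ id , id ]′ (transmitted r)

inputPackets : ∀ {capacity T Q} {σ : Input T} → Run capacity Q σ → List Packet
inputPackets r = mapMaybe isInj₂ (transmitted r)

-- An optimal schedule need not be unique: OPT B σ is the type of all of them.
record OPT {capacity T} (B : BufferState capacity) (σ : Input T) : Set where
  field
    schedule : Schedule B σ
    optimal  : ∀ (s : Schedule B σ) → v (allPackets s) ≤ℝ v (allPackets schedule)

OPT-part : ∀ {capacity T} {B : BufferState capacity} {σ : Input T} → OPT B σ → List Packet
OPT-part O = inputPackets (OPT.schedule O)

{-# OPTIONS --safe #-}

-- Simulate an arbitrary run from B by a run from ∅ which makes the same
-- decisions about the packets of the input. Not being delayed by the packets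
-- of B, the simulation is always ahead: at each moment the input packets
-- buffered by the original run are P ++ S, where S is the buffer of the
-- simulation and the packets of P have already been sent by it. Hence whatever
-- the original run sends, the simulation sends too, and the comparison follows
-- from the optimality of the schedule from ∅ since values are nonnegative.
module Submission where

open import Defs
open import Data.Integer.Base as ℤ using (+_; -[1+_])
import Data.Integer.Properties as ℤ
open import Data.List.Base using (List; []; _∷_; [_]; _++_; length; map; mapMaybe)
open import Data.List.Properties
  using (++-assoc; length-++; length-map; length-mapMaybe; map-++; mapMaybe-++; ∷-injective)
open import Data.List.Relation.Binary.Sublist.Propositional
  using (_⊆_; []; _∷_; _∷ʳ_; ⊆-refl; ⊆-trans)
open import Data.List.Relation.Binary.Sublist.Propositional.Properties
  using (map⁺; ++⁺; ++⁺ˡ; length-mono-≤)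
open import Data.Nat.Base as ℕ using (ℕ; suc)
import Data.Nat.Properties as ℕ
open import Data.Product using (∃-syntax; _×_; _,_)
open import Data.Rational.Base as ℚ using (ℚ; mkℚ; 0ℚ; ∣_∣; *≤*)
import Data.Rational.Properties as ℚ
open import Data.Rational.Solver using (module +-*-Solver)
open import Data.Sum using (inj₁; inj₂; isInj₂)
open import Data.Vec.Base using ([]; _∷_)
open import Relation.Binary.PropositionalEquality hiding ([_])
open import Relation.Nullary using (contradiction)

0≤1/1+ : ∀ n → 0ℚ ℚ.≤ 1/1+ n
0≤1/1+ n = ℚ.nonNegative⁻¹ (1/1+ n)

p≤q+p : ∀ {p q} → 0ℚ ℚ.≤ q → p ℚ.≤ q ℚ.+ p
p≤q+p {p} {q} 0≤q = begin
  p         ≡⟨ ℚ.+-identityˡ p ⟨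
  0ℚ ℚ.+ p  ≤⟨ ℚ.+-monoˡ-≤ p 0≤q ⟩
  q ℚ.+ p   ∎
  where open ℚ.≤-Reasoning

p≤∣p∣ : ∀ p → p ℚ.≤ ∣ p ∣
p≤∣p∣ (mkℚ (+ _)    _ _) = ℚ.≤-refl
p≤∣p∣ (mkℚ -[1+ _ ] _ _) = *≤* ℤ.-≤+

∣p-q∣≤r⇒p≤q+r : ∀ {p q r} → ∣ p ℚ.- q ∣ ℚ.≤ r → p ℚ.≤ q ℚ.+ r
∣p-q∣≤r⇒p≤q+r {p} {q} {r} ∣p-q∣≤r = begin
  p                   ≡⟨ solve 2 (λ p q → p := q :+ (p :- q)) refl p q ⟩
  q ℚ.+ (p ℚ.- q)     ≤⟨ ℚ.+-monoʳ-≤ q (p≤∣p∣ (p ℚ.- q)) ⟩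
  q ℚ.+ ∣ p ℚ.- q ∣   ≤⟨ ℚ.+-monoʳ-≤ q ∣p-q∣≤r ⟩
  q ℚ.+ r             ∎
  where
  open ℚ.≤-Reasoning
  open +-*-Solver

seq-close : ∀ x m n → seq x m ℚ.≤ seq x n ℚ.+ (1/1+ m ℚ.+ 1/1+ n)
seq-close x m n = ∣p-q∣≤r⇒p≤q+r {seq x m} {seq x n} (regular x m n)

-- If p = (k+1)/(d+1) were positive, p ≤ 1/(d+2) would fail.
archimedean₀ : ∀ p → (∀ n → p ℚ.≤ 1/1+ n) → p ℚ.≤ 0ℚ
archimedean₀ (mkℚ -[1+ _ ]  d _) _ = *≤* ℤ.-≤+
archimedean₀ (mkℚ (+ 0)     d _) _ = *≤* ℤ.≤-refl
archimedean₀ (mkℚ (+ suc k) d _) p≤1/ with p≤1/ (suc d)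
... | *≤* le = contradiction (ℕ.≤-trans (ℕ.m≤m+n (2 ℕ.+ d) (k ℕ.* (2 ℕ.+ d))) (ℤ.drop‿+≤+ le))
                 λ le′ → ℕ.<-irrefl refl (subst (2 ℕ.+ d ℕ.≤_) (ℕ.+-identityʳ (suc d)) le′)

archimedean : ∀ {p q} → (∀ n → p ℚ.≤ q ℚ.+ 1/1+ n) → p ℚ.≤ q
archimedean {p} {q} p≤q+1/ = begin
  p                 ≡⟨ solve 2 (λ p q → p := q :+ (p :- q)) refl p q ⟩
  q ℚ.+ (p ℚ.- q)   ≤⟨ ℚ.+-monoʳ-≤ q (archimedean₀ (p ℚ.- q) p-q≤1/) ⟩
  q ℚ.+ 0ℚ          ≡⟨ ℚ.+-identityʳ q ⟩
  q                 ∎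
  where
  open ℚ.≤-Reasoning
  open +-*-Solver
  p-q≤1/ : ∀ n → p ℚ.- q ℚ.≤ 1/1+ n
  p-q≤1/ n = begin
    p ℚ.- q                 ≤⟨ ℚ.+-monoˡ-≤ (ℚ.- q) (p≤q+1/ n) ⟩
    (q ℚ.+ 1/1+ n) ℚ.- q    ≡⟨ solve 2 (λ q e → (q :+ e) :- q := e) refl q (1/1+ n) ⟩
    1/1+ n                  ∎

quadruple : ℕ → ℕ
quadruple n = double (double n)

2/1+quadruple : ∀ n → 1/1+ quadruple n ℚ.+ 1/1+ quadruple n ≡ 1/1+ double n
2/1+quadruple n = 1/1+double (double n)

1/1+double≤ : ∀ n → 1/1+ double n ℚ.≤ 1/1+ n
1/1+double≤ n = begin
  1/1+ double n                    ≤⟨ p≤q+p (0≤1/1+ (double n)) ⟩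
  1/1+ double n ℚ.+ 1/1+ double n  ≡⟨ 1/1+double n ⟩
  1/1+ n                           ∎
  where open ℚ.≤-Reasoning

-- At the index quadruple n the error is 1/(4(n+1)), so this criterion tolerates
-- four of them where the definition of _≤ℝ_ tolerates two.
≤ℝ-quadruple : ∀ x y → (∀ n → seq x (quadruple n) ℚ.≤ seq y (quadruple n) ℚ.+ 1/1+ n) → x ≤ℝ y
≤ℝ-quadruple x y x≤y n = archimedean λ j →
  let k = double j
      m = quadruple k
      xₙ = seq x n
      xₘ = seq x m
      yₙ = seq y n
      yₘ = seq y m
      eₖ = 1/1+ k
      eₘ = 1/1+ m
      eₙ = 1/1+ n
  in begin
  xₙ                                                ≤⟨ seq-close x n m ⟩
  xₘ ℚ.+ (eₙ ℚ.+ eₘ)                                ≤⟨ ℚ.+-monoˡ-≤ (eₙ ℚ.+ eₘ) (x≤y k) ⟩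
  yₘ ℚ.+ eₖ ℚ.+ (eₙ ℚ.+ eₘ)                         ≤⟨ ℚ.+-monoˡ-≤ (eₙ ℚ.+ eₘ) (ℚ.+-monoˡ-≤ eₖ (seq-close y m n)) ⟩
  yₙ ℚ.+ (eₘ ℚ.+ eₙ) ℚ.+ eₖ ℚ.+ (eₙ ℚ.+ eₘ)         ≡⟨ solve 4 (λ a b c d →
                                                         a :+ (b :+ c) :+ d :+ (c :+ b) :=
                                                         a :+ (c :+ c) :+ ((b :+ b) :+ d))
                                                         refl yₙ eₘ eₙ eₖ ⟩
  yₙ ℚ.+ (eₙ ℚ.+ eₙ) ℚ.+ ((eₘ ℚ.+ eₘ) ℚ.+ eₖ)       ≡⟨ cong (λ e → yₙ ℚ.+ (eₙ ℚ.+ eₙ) ℚ.+ (e ℚ.+ eₖ)) (2/1+quadruple k) ⟩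
  yₙ ℚ.+ (eₙ ℚ.+ eₙ) ℚ.+ (1/1+ double k ℚ.+ eₖ)     ≤⟨ ℚ.+-monoʳ-≤ (yₙ ℚ.+ (eₙ ℚ.+ eₙ)) (ℚ.+-monoˡ-≤ eₖ (1/1+double≤ k)) ⟩
  yₙ ℚ.+ (eₙ ℚ.+ eₙ) ℚ.+ (eₖ ℚ.+ eₖ)                ≡⟨ cong (λ e → yₙ ℚ.+ (eₙ ℚ.+ eₙ) ℚ.+ e) (1/1+double j) ⟩
  yₙ ℚ.+ (eₙ ℚ.+ eₙ) ℚ.+ 1/1+ j                     ∎
  where
  open ℚ.≤-Reasoning
  open +-*-Solver

4/1+quadruple : ∀ n → let e = 1/1+ quadruple n in (e ℚ.+ e) ℚ.+ (e ℚ.+ e) ≡ 1/1+ n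
4/1+quadruple n = trans (cong₂ ℚ._+_ (2/1+quadruple n) (2/1+quadruple n)) (1/1+double n)

≤ℝ-refl : ∀ x → x ≤ℝ x
≤ℝ-refl x n = seq-close x n n

≤ℝ-trans : ∀ x y z → x ≤ℝ y → y ≤ℝ z → x ≤ℝ z
≤ℝ-trans x y z x≤y y≤z = ≤ℝ-quadruple x z λ n →
  let m = quadruple n
      e = 1/1+ m
  in begin
  seq x m                                  ≤⟨ x≤y m ⟩
  seq y m ℚ.+ (e ℚ.+ e)                    ≤⟨ ℚ.+-monoˡ-≤ (e ℚ.+ e) (y≤z m) ⟩
  seq z m ℚ.+ (e ℚ.+ e) ℚ.+ (e ℚ.+ e)      ≡⟨ ℚ.+-assoc (seq z m) (e ℚ.+ e) (e ℚ.+ e) ⟩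
  seq z m ℚ.+ ((e ℚ.+ e) ℚ.+ (e ℚ.+ e))    ≡⟨ cong (seq z m ℚ.+_) (4/1+quadruple n) ⟩
  seq z m ℚ.+ 1/1+ n                       ∎
  where open ℚ.≤-Reasoning

+ℝ-monoʳ-≤ℝ : ∀ z x y → x ≤ℝ y → z +ℝ x ≤ℝ z +ℝ y
+ℝ-monoʳ-≤ℝ z x y x≤y n =
  let m = double n
      e = 1/1+ m
  in begin
  seq z m ℚ.+ seq x m                      ≤⟨ ℚ.+-monoʳ-≤ (seq z m) (x≤y m) ⟩
  seq z m ℚ.+ (seq y m ℚ.+ (e ℚ.+ e))      ≡⟨ ℚ.+-assoc (seq z m) (seq y m) (e ℚ.+ e) ⟨
  seq z m ℚ.+ seq y m ℚ.+ (e ℚ.+ e)        ≤⟨ ℚ.+-monoʳ-≤ (seq z m ℚ.+ seq y m)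
                                                (ℚ.+-mono-≤ (1/1+double≤ n) (1/1+double≤ n)) ⟩
  seq z m ℚ.+ seq y m ℚ.+ (1/1+ n ℚ.+ 1/1+ n) ∎
  where open ℚ.≤-Reasoning

x≤ℝy+x : ∀ x y → 0ℝ ≤ℝ y → x ≤ℝ y +ℝ x
x≤ℝy+x x y 0≤y = ≤ℝ-quadruple x (y +ℝ x) λ n →
  let m  = quadruple n
      d  = double m
      e  = 1/1+ m
      e′ = 1/1+ d
      xd = seq x d
      yd = seq y d
  in begin
  seq x m                                              ≤⟨ seq-close x m d ⟩
  xd ℚ.+ (e ℚ.+ e′)                                    ≤⟨ p≤q+p (0≤y d) ⟩
  yd ℚ.+ (e′ ℚ.+ e′) ℚ.+ (xd ℚ.+ (e ℚ.+ e′))          ≡⟨ solve 5 (λ o y x e f →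
                                                            y :+ f :+ (x :+ (e :+ o)) :=
                                                            y :+ x :+ ((e :+ f) :+ o))
                                                            refl e′ yd xd e (e′ ℚ.+ e′) ⟩
  yd ℚ.+ xd ℚ.+ ((e ℚ.+ (e′ ℚ.+ e′)) ℚ.+ e′)           ≡⟨ cong (λ f → yd ℚ.+ xd ℚ.+ ((e ℚ.+ f) ℚ.+ e′)) (1/1+double m) ⟩
  yd ℚ.+ xd ℚ.+ ((e ℚ.+ e) ℚ.+ e′)                     ≤⟨ ℚ.+-monoʳ-≤ (yd ℚ.+ xd) (ℚ.+-monoʳ-≤ (e ℚ.+ e)
                                                            (ℚ.≤-trans (1/1+double≤ m) (p≤q+p (0≤1/1+ m)))) ⟩
  yd ℚ.+ xd ℚ.+ ((e ℚ.+ e) ℚ.+ (e ℚ.+ e))              ≡⟨ cong (yd ℚ.+ xd ℚ.+_) (4/1+quadruple n) ⟩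
  yd ℚ.+ xd ℚ.+ 1/1+ n                                 ∎
  where
  open ℚ.≤-Reasoning
  open +-*-Solver

v-mono-⊆ : ∀ {ps qs} → ps ⊆ qs → v ps ≤ℝ v qs
v-mono-⊆ []                            = ≤ℝ-refl 0ℝ
v-mono-⊆ {ps} {q ∷ qs} (_ ∷ʳ τ)        = ≤ℝ-trans (v ps) (v qs) (v (q ∷ qs)) (v-mono-⊆ τ)
                                           (x≤ℝy+x (v qs) (value q) (nonneg q))
v-mono-⊆ {p ∷ ps} {_ ∷ qs} (refl ∷ τ)  = +ℝ-monoʳ-≤ℝ (value p) (v ps) (v qs) (v-mono-⊆ τ)

⊆-split : ∀ {a} {A : Set a} ps {qs xs : List A} → xs ⊆ ps ++ qs →
          ∃[ ps′ ] ∃[ qs′ ] ps′ ⊆ ps × qs′ ⊆ qs × xs ≡ ps′ ++ qs′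
⊆-split []       τ = [] , _ , [] , τ , refl
⊆-split (p ∷ ps) (_ ∷ʳ τ) with ⊆-split ps τ
... | ps′ , qs′ , α , β , eq = ps′ , qs′ , p ∷ʳ α , β , eq
⊆-split (p ∷ ps) (refl ∷ τ) with ⊆-split ps τ
... | ps′ , qs′ , α , β , eq = p ∷ ps′ , qs′ , refl ∷ α , β , cong (p ∷_) eq

⊆-map⁻ : ∀ {a b} {A : Set a} {B : Set b} (f : A → B) xs {ys} → ys ⊆ map f xs →
         ∃[ xs′ ] ys ≡ map f xs′
⊆-map⁻ f []       []         = [] , refl
⊆-map⁻ f (x ∷ xs) (_ ∷ʳ τ)   = ⊆-map⁻ f xs τ
⊆-map⁻ f (x ∷ xs) (refl ∷ τ) with ⊆-map⁻ f xs τ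
... | xs′ , eq = x ∷ xs′ , cong (f x ∷_) eq

arrived : Contents → List Packet
arrived = mapMaybe isInj₂

arrived-⊆ : ∀ {Q′ Q} → Q′ ⊆ Q → arrived Q′ ⊆ arrived Q
arrived-⊆ []                     = []
arrived-⊆ (inj₁ _ ∷ʳ τ)          = arrived-⊆ τ
arrived-⊆ (inj₂ p ∷ʳ τ)          = p ∷ʳ arrived-⊆ τ
arrived-⊆ {inj₁ _ ∷ _} (refl ∷ τ) = arrived-⊆ τ
arrived-⊆ {inj₂ _ ∷ _} (refl ∷ τ) = refl ∷ arrived-⊆ τ

arrival-arrived : ∀ {c p Q′} S → Arrival c (map inj₂ S) p Q′ → ∃[ S′ ] Q′ ≡ map inj₂ S′
arrival-arrived S (drop τ) = ⊆-map⁻ inj₂ S τ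
arrival-arrived {p = p} S (accept τ _) with ⊆-map⁻ inj₂ S τ
... | S′ , refl = S′ ++ [ p ] , sym (map-++ inj₂ S′ [ p ])

arrivalPhase-arrived : ∀ {c ps Q′} S → ArrivalPhase c (map inj₂ S) ps Q′ → ∃[ S′ ] Q′ ≡ map inj₂ S′
arrivalPhase-arrived S []       = S , refl
arrivalPhase-arrived S (a ∷ as) with arrival-arrived S a
... | S′ , refl = arrivalPhase-arrived S′ as

inputPackets≡allPackets : ∀ {c T} {σ : Input T} S (r : Run c (map inj₂ S) σ) →
                          inputPackets r ≡ allPackets r
inputPackets≡allPackets S []       = refl
inputPackets≡allPackets S (as ∷ r) with arrivalPhase-arrived S as
... | []     , refl = inputPackets≡allPackets [] r
... | x ∷ S′ , refl = cong (x ∷_) (inputPackets≡allPackets S′ r)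

preempt-simulation : ∀ {Q Q′} P S → Q′ ⊆ Q → arrived Q ≡ P ++ S →
                     ∃[ P′ ] ∃[ S′ ] P′ ⊆ P × S′ ⊆ S × arrived Q′ ≡ P′ ++ S′
preempt-simulation P S τ eq = ⊆-split P (subst (_ ⊆_) eq (arrived-⊆ τ))

arrival-simulation : ∀ {c p Q Q′} P S → Arrival c Q p Q′ → arrived Q ≡ P ++ S →
                     ∃[ P′ ] ∃[ S′ ] P′ ⊆ P × Arrival c (map inj₂ S) p (map inj₂ S′) × arrived Q′ ≡ P′ ++ S′
arrival-simulation P S (drop τ) eq with preempt-simulation P S τ eq
... | P′ , S′ , α , β , eq′ = P′ , S′ , α , drop (map⁺ inj₂ β) , eq′
arrival-simulation {c} {p} P S (accept {Q′} τ fits) eq with preempt-simulation P S τ eq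
... | P′ , S′ , α , β , eq′ =
  P′ , S′ ++ [ p ] , α
  , subst (Arrival c (map inj₂ S) p) (sym (map-++ inj₂ S′ [ p ])) (accept (map⁺ inj₂ β) fits′)
  , arrived-eq
  where
  S′≤Q′ : length (map inj₂ S′) ℕ.≤ length Q′
  S′≤Q′ = begin
    length (map inj₂ S′)     ≡⟨ length-map inj₂ S′ ⟩
    length S′                ≤⟨ length-mono-≤ (++⁺ˡ P′ ⊆-refl) ⟩
    length (P′ ++ S′)        ≡⟨ cong length eq′ ⟨
    length (arrived Q′)      ≤⟨ length-mapMaybe isInj₂ Q′ ⟩
    length Q′                ∎
    where open ℕ.≤-Reasoning
  fits′ : length (map inj₂ S′ ++ [ inj₂ p ]) ℕ.≤ c
  fits′ = begin
    length (map inj₂ S′ ++ [ inj₂ p ])   ≡⟨ length-++ (map inj₂ S′) ⟩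
    length (map inj₂ S′) ℕ.+ 1       ≤⟨ ℕ.+-monoˡ-≤ 1 S′≤Q′ ⟩
    length Q′ ℕ.+ 1                  ≡⟨ length-++ Q′ ⟨
    length (Q′ ++ [ inj₂ p ])            ≤⟨ fits ⟩
    c                                ∎
    where open ℕ.≤-Reasoning
  arrived-eq : arrived (Q′ ++ [ inj₂ p ]) ≡ P′ ++ (S′ ++ [ p ])
  arrived-eq = begin
    arrived (Q′ ++ [ inj₂ p ])   ≡⟨ mapMaybe-++ isInj₂ Q′ [ inj₂ p ] ⟩
    arrived Q′ ++ [ p ]          ≡⟨ cong (_++ [ p ]) eq′ ⟩
    (P′ ++ S′) ++ [ p ]          ≡⟨ ++-assoc P′ S′ [ p ] ⟩
    P′ ++ (S′ ++ [ p ])          ∎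
    where open ≡-Reasoning

arrivalPhase-simulation : ∀ {c ps Q Q′} P S → ArrivalPhase c Q ps Q′ → arrived Q ≡ P ++ S →
                          ∃[ P′ ] ∃[ S′ ] P′ ⊆ P × ArrivalPhase c (map inj₂ S) ps (map inj₂ S′) ×
                                          arrived Q′ ≡ P′ ++ S′
arrivalPhase-simulation P S []       eq = P , S , ⊆-refl , [] , eq
arrivalPhase-simulation P S (a ∷ as) eq with arrival-simulation P S a eq
... | P₁ , S₁ , α , a′ , eq₁ with arrivalPhase-simulation P₁ S₁ as eq₁
... | P₂ , S₂ , β , as′ , eq₂ = P₂ , S₂ , ⊆-trans β α , a′ ∷ as′ , eq₂

run-simulation : ∀ {c T Q} {σ : Input T} P S (r : Run c Q σ) → arrived Q ≡ P ++ S →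
                 ∃[ s ] inputPackets r ⊆ P ++ inputPackets {c} {T} {map inj₂ S} {σ} s
transmission-simulation : ∀ {c T Q} {σ : Input T} P S (r : Run c (remaining Q) σ) → arrived Q ≡ P ++ S →
                          ∃[ s ] arrived (sent Q ++ transmitted r) ⊆
                                 P ++ arrived (sent (map inj₂ S) ++ transmitted {c} {T} {remaining (map inj₂ S)} {σ} s)

run-simulation P S []       eq = [] , ++⁺ˡ P []
run-simulation P S (_∷_ {Q′ = Q′} as r) eq with arrivalPhase-simulation P S as eq
... | P′ , S′ , α , as′ , eq′ with transmission-simulation {Q = Q′} P′ S′ r eq′
... | s , β = as′ ∷ s , ⊆-trans β (++⁺ α ⊆-refl)

transmission-simulation {Q = []}         []      []      r eq = run-simulation [] [] r refl
transmission-simulation {Q = inj₁ _ ∷ Q} P       []      r eq = run-simulation P [] r eq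
transmission-simulation {Q = inj₁ _ ∷ Q} P       (x ∷ S) r eq
  with run-simulation (P ++ [ x ]) S r (trans eq (sym (++-assoc P [ x ] S)))
... | s , β = s , subst (inputPackets r ⊆_) (++-assoc P [ x ] (inputPackets s)) β
transmission-simulation {Q = inj₂ _ ∷ Q} []      (x ∷ S) r eq with ∷-injective eq
... | refl , eq′ with run-simulation [] S r eq′
... | s , β = s , refl ∷ β
transmission-simulation {Q = inj₂ _ ∷ Q} (x ∷ P) []      r eq with ∷-injective eq
... | refl , eq′ with run-simulation P [] r eq′
... | s , β = s , refl ∷ β
transmission-simulation {Q = inj₂ _ ∷ Q} (x ∷ P) (y ∷ S) r eq with ∷-injective eq
... | refl , eq′ with run-simulation (P ++ [ y ]) S r (trans eq′ (sym (++-assoc P [ y ] S)))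
... | s , β = s , refl ∷ subst (inputPackets r ⊆_) (++-assoc P [ y ] (inputPackets s)) β

arrived-map-inj₁ : ∀ ps → arrived (map inj₁ ps) ≡ []
arrived-map-inj₁ []       = refl
arrived-map-inj₁ (_ ∷ ps) = arrived-map-inj₁ ps

proposition13 : ∀ (capacity T : ℕ) (B : BufferState capacity) (σ : Input T)
    (opt∅ : OPT {capacity} ∅ σ) (optB : OPT B σ) →
    v (OPT-part opt∅) ≥ℝ v (OPT-part optB)
proposition13 capacity T B σ opt∅ optB
  with run-simulation [] [] (OPT.schedule optB) (arrived-map-inj₁ (packets B))
... | s , optB⊆s =
  subst (λ ps → v (OPT-part optB) ≤ℝ v ps) (sym (inputPackets≡allPackets [] (OPT.schedule opt∅)))
    (≤ℝ-trans (v (OPT-part optB)) (v (allPackets s)) (v (allPackets (OPT.schedule opt∅)))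
      (v-mono-⊆ (subst (OPT-part optB ⊆_) (inputPackets≡allPackets [] s) optB⊆s))
      (OPT.optimal opt∅ s))
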